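{- Let $(W,S)$ be an arbitrary Coxeter system and let $\omega=(\omega_1,\dots,\omega_m)$ and $\zeta=(\zeta_1,\dots,\zeta_m)$ be two finite words in the generators $S$ that differ by the exchange of commuting generators in positions $i$ and $i+1$ (that is, $\omega_i=\zeta_{i+1}$, $\omega_{i+1}=\zeta_i$, $\omega_i\omega_{i+1}=\omega_{i+1}\omega_i$ in $W$, and $\omega_j=\zeta_j$ for $j\notin\{i,i+1\}$). Then $W_\omega=W_\zeta$ and for all $u,w\in W_\omega=W_\zeta$, $$u\leq_\omega w\iff u\leq_\zeta w.$$
   Context: $\ell$ denotes the length function of $(W,S)$. For a finite word $\omega=(\omega_1,\dots,\omega_m)$ in $S$, a subword $\alpha\subseteq\omega$ is identified with its index set $I(\alpha)=\{i_1<\dots<i_k\}\subseteq I(\omega)=\{1,\dots,m\}$, with $\alpha=(\omega_{i_1},\dots,\omega_{i_k})$. For a word $\alpha=(\alpha_1,\dots,\alpha_k)$ write $\langle\alpha\rangle=\alpha_1\cdots\alpha_k\in W$; $\alpha$ is reduced if $k=\ell(\langle\alpha\rangle)$. $W_\omega\subseteq W$ is the set of elements $\langle\alpha\rangle$ for subwords $\alpha\subseteq\omega$. For $A,B\subseteq I(\omega)$, $A\leq_{\mathsf{lex}}B$ means $A=B$ or $\min((A\cup B)\setminus(A\cap B))\in A$. For $u\in W_\omega$, the $\omega$-sorted word $\mathsf{sort}_\omega(u)$ is the subword of $\omega$ whose index set is $\leq_{\mathsf{lex}}$-minimum among index sets of subwords of $\omega$ that are reduced words for $u$. The $\omega$-sorting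 order on $W_\omega$ is: $u\leq_\omega w$ iff $I(\mathsf{sort}_\omega(u))\subseteq I(\mathsf{sort}_\omega(w))$. The order $\leq_\zeta$ on $W_\zeta$ is defined the same way from $\zeta$. -}

module Defs where

open import Level using (Level; _⊔_) renaming (suc to lsuc)
open import Algebra.Bundles using (Group)
open import Data.Bool.Base using (true; false)
open import Data.Fin.Base as Fin using (Fin)
open import Data.Fin.Subset using (Subset; _∈_; _⊆_; _∪_; _∩_; _─_)
open import Data.List.Base using (List; []; _∷_; _++_; map; foldr; length; concat; replicate)
open import Data.Nat.Base using (ℕ; _≤_)
open import Data.Product.Base using (∃; ∃₂; _×_)
open import Data.Sum.Base using (_⊎_)
open import Data.Vec.Base using (Vec; []; _∷_)
open import Function.Bundles using (_⇔_)
open import Relation.Binary.Core using (Rel)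
open import Relation.Binary.Construct.Closure.Equivalence using (EqClosure)
open import Relation.Binary.PropositionalEquality.Core using (_≡_)
open import Relation.Unary using (Pred)

private variable
  a c ℓ : Level

-- The entry 0 stands for m(s,t) = ∞, so off-diagonal entries are ≥ 2 or ∞.
record CoxeterMatrix (S : Set a) : Set a where
  field
    m        : S → S → ℕ
    m-sym    : ∀ s t → m s t ≡ m t s
    m≡1⇔s≡t : ∀ s t → m s t ≡ 1 ⇔ s ≡ t

  -- (s t)^m(s,t), which is the empty word when m(s,t) = ∞.
  relator : S → S → List S
  relator s t = concat (replicate (m s t) (s ∷ t ∷ []))

  data _⟶_ : Rel (List S) a where
    delete : ∀ α s t β → (α ++ relator s t ++ β) ⟶ (α ++ β)

  -- The congruence on words generated by (s t)^m(s,t) = 1.  Formal inverses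
  -- are not needed: m(s,s) = 1 gives the relation s s = 1, so the monoid
  -- with these relations is already the group with these relations.
  _∼_ : Rel (List S) a
  _∼_ = EqClosure _⟶_

-- The carrier of W is a setoid, so equality in W is the group's _≈_.
-- S is a subset of W via the injective map gen.
record CoxeterSystem (a c ℓ : Level) : Set (lsuc (a ⊔ c ⊔ ℓ)) where
  field
    W      : Group c ℓ
    S      : Set a
    matrix : CoxeterMatrix S

  open Group W public using (Carrier; _≈_; _∙_; ε)
  open CoxeterMatrix matrix public

  field
    gen : S → Carrier

  ⟨_⟩ : List S → Carrier
  ⟨ α ⟩ = foldr _∙_ ε (map gen α)

  field
    gen-injective : ∀ {s t} → gen s ≈ gen t → s ≡ t
    generates     : ∀ w → ∃ λ α → ⟨ α ⟩ ≈ w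
    presentation  : ∀ α β → ⟨ α ⟩ ≈ ⟨ β ⟩ ⇔ α ∼ β

subword : ∀ {A : Set a} {n} → Vec A n → Subset n → List A
subword []      []          = []
subword (s ∷ ω) (true  ∷ I) = s ∷ subword ω I
subword (s ∷ ω) (false ∷ I) = subword ω I

IsMin : ∀ {n} → Subset n → Fin n → Set
IsMin I k = k ∈ I × (∀ {l} → l ∈ I → k Fin.≤ l)

_≤lex_ : ∀ {n} → Rel (Subset n) _
A ≤lex B = A ≡ B ⊎ ∃ λ k → IsMin ((A ∪ B) ─ (A ∩ B)) k × k ∈ A

module Sorting (C : CoxeterSystem a c ℓ) where
  open CoxeterSystem C

  -- The length function and ω ↦ sort_ω(u) are given by their graphs: both are
  -- minima, and computing them would require deciding equality in W.

  -- ℓ(w) = k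
  HasLength : Carrier → ℕ → Set (a ⊔ ℓ)
  HasLength w k = (∃ λ α → ⟨ α ⟩ ≈ w × length α ≡ k)
                × (∀ α → ⟨ α ⟩ ≈ w → k ≤ length α)

  Reduced : List S → Set (a ⊔ ℓ)
  Reduced α = HasLength ⟨ α ⟩ (length α)

  ReducedWordFor : Carrier → List S → Set (a ⊔ ℓ)
  ReducedWordFor u α = Reduced α × ⟨ α ⟩ ≈ u

  W⟨_⟩ : ∀ {n} → Vec S n → Pred Carrier ℓ
  W⟨ ω ⟩ u = ∃ λ I → ⟨ subword ω I ⟩ ≈ u

  -- I = I(sort_ω(u)); there is at most one such I, as ≤lex is antisymmetric.
  IsSort : ∀ {n} → Vec S n → Carrier → Subset n → Set (a ⊔ ℓ)
  IsSort ω u I = ReducedWordFor u (subword ω I)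
               × (∀ J → ReducedWordFor u (subword ω J) → I ≤lex J)

  _≤[_]_ : ∀ {n} → Carrier → Vec S n → Carrier → Set (a ⊔ ℓ)
  u ≤[ ω ] w = ∃₂ λ I J → IsSort ω u I × IsSort ω w J × I ⊆ J

{-# OPTIONS --safe #-}
module Submission where

-- Exchanging bits i and i+1 of index sets matches the subwords of ω and ζ, hence
-- W_ω and W_ζ, lengths and inclusions.  It preserves ≤lex except where one index set
-- contains i but not i+1 and the other i+1 but not i.  If both are reduced words for u,
-- say u = p s q = p t q′ with st = ts and s ≠ t, then the exchange condition deletes a
-- letter of q to give u = p s t q″.  The index set of p s t q″ is smaller than that of
-- p s q, so the latter is not sort_ω(u) and the exceptional case does not occur.
--
-- The exchange condition follows from Tits' parity argument: the parity of the
-- multiplicity of a reflection among the t₁, …, tₖ of a word depends only on the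
-- element of W, since the reflections of a relator cancel in pairs.

open import Defs
open import Algebra.Bundles using (Group)
import Algebra.Properties.Group as GroupProperties
open import Data.Bool.Base using (Bool; true; false; not; _xor_)
open import Data.Bool.Properties using (not-involutive; xor-same)
open import Data.Fin.Base using (Fin; zero; suc; toℕ)
open import Data.Fin.Subset as Subset using (Subset; _⊆_; _∪_; _∩_; _─_)
open import Data.Fin.Subset.Properties using (drop-∷-⊆)
open import Data.List.Base as List using (List; []; _∷_; map; length; concat; replicate; iterate)
import Data.List.Properties as List
open import Data.List.Relation.Unary.Any as Any using (Any; here; there)
open import Data.List.Relation.Unary.Any.Properties using (map⁻)
import Data.List.Relation.Binary.Equality.Setoid as ListEquality
open import Data.Nat.Base as ℕ using (ℕ; zero; suc; z≤n; s≤s)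
open import Data.Nat.GeneralisedArithmetic using (fold; fold-+)
import Data.Nat.Properties as ℕ
open import Data.Product.Base using (∃; _×_; _,_; proj₁; proj₂)
open import Data.Sum.Base using (_⊎_; inj₁; inj₂)
open import Data.Vec.Base using (Vec; []; _∷_; _++_; lookup; here; there; splitAt)
open import Data.Vec.Properties using (tabulate∘lookup; tabulate-cong)
open import Function.Bundles using (_⇔_; Equivalence; mk⇔)
open import Level using (Level; _⊔_)
open import Relation.Binary.Bundles using (Setoid)
import Relation.Binary.Construct.Closure.Equivalence as EqClosure
open import Relation.Binary.PropositionalEquality.Core as ≡ using (_≡_; _≢_; refl; cong)
import Relation.Binary.Reasoning.Setoid as ≈-Reasoning
open import Relation.Binary.Structures using (IsEquivalence)
open import Relation.Nullary using (¬_; Dec; yes; no; contradiction)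
open import Relation.Nullary.Decidable using (map′; ¬¬-excluded-middle)
open import Relation.Unary using (_∈_; _≐_)

private variable
  a c ℓ : Level
  k n : ℕ

-- Lexicographic comparison of index sets.

-- A recursive form of `≤lex`: a common prefix, then `lead` at the first difference. It can be
-- matched along a decomposition `A ++ a ∷ b ∷ B`.
data Lex : Subset n → Subset n → Set where
  []   : Lex [] []
  _∷_  : ∀ b {A B : Subset n} → Lex A B → Lex (b ∷ A) (b ∷ B)
  lead : ∀ {A B : Subset n} → Lex (true ∷ A) (false ∷ B)

Lex-refl : ∀ (A : Subset n) → Lex A A
Lex-refl []      = []
Lex-refl (b ∷ A) = b ∷ Lex-refl A

≤lex⇒Lex : ∀ {A B : Subset n} → A ≤lex B → Lex A B
≤lex⇒Lex (inj₁ refl) = Lex-refl _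
≤lex⇒Lex (inj₂ (k , k-min , k∈A)) = from-min k _ _ k-min k∈A
  where
  from-min : ∀ {n} (k : Fin n) A B → IsMin ((A ∪ B) ─ (A ∩ B)) k → k Subset.∈ A → Lex A B
  from-min zero    (true ∷ A)  (false ∷ B) _ _ = lead
  from-min zero    (true ∷ A)  (true ∷ B)  (() , _) _
  from-min (suc k) (true ∷ A)  (true ∷ B)  (there p , m) (there q) =
    true ∷ from-min k A B (p , λ l → ℕ.s≤s⁻¹ (m (there l))) q
  from-min (suc k) (false ∷ A) (false ∷ B) (there p , m) (there q) =
    false ∷ from-min k A B (p , λ l → ℕ.s≤s⁻¹ (m (there l))) q
  from-min (suc k) (true ∷ A)  (false ∷ B) (_ , m) _ with () ← m here
  from-min (suc k) (false ∷ A) (true ∷ B)  (_ , m) _ with () ← m here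

Lex⇒≤lex : ∀ {A B : Subset n} → Lex A B → A ≤lex B
Lex⇒≤lex []   = inj₁ refl
Lex⇒≤lex lead = inj₂ (zero , (here , λ _ → z≤n) , here)
Lex⇒≤lex (b ∷ A≤B) with Lex⇒≤lex A≤B
... | inj₁ refl = inj₁ refl
Lex⇒≤lex (true ∷ A≤B) | inj₂ (k , (p , m) , q) =
  inj₂ (suc k , (there p , λ { (there l) → s≤s (m l) }) , there q)
Lex⇒≤lex (false ∷ A≤B) | inj₂ (k , (p , m) , q) =
  inj₂ (suc k , (there p , λ { (there l) → s≤s (m l) }) , there q)

-- Exchanging two adjacent bits.

-- The two-bit blocks are ordered 11, 10, 01, 00, and exchanging the bits transposes only the middle
-- two. So a comparison can break only for 10 against 01 after equal prefixes.
Lex-swap : ∀ (A A′ : Subset k) {a b a′ b′} {B B′ : Subset n} →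
           Lex (A ++ a ∷ b ∷ B) (A′ ++ a′ ∷ b′ ∷ B′) →
           Lex (A ++ b ∷ a ∷ B) (A′ ++ b′ ∷ a′ ∷ B′) ⊎
           (A ≡ A′ × (a ≡ true × b ≡ false) × (a′ ≡ false × b′ ≡ true))
Lex-swap []      []       (a ∷ (b ∷ l)) = inj₁ (b ∷ (a ∷ l))
Lex-swap []      []       (a ∷ lead)    = inj₁ lead
Lex-swap []      []       {b = true}  {b′ = true}  lead = inj₁ (true ∷ lead)
Lex-swap []      []       {b = true}  {b′ = false} lead = inj₁ lead
Lex-swap []      []       {b = false} {b′ = true}  lead = inj₂ (refl , (refl , refl) , (refl , refl))
Lex-swap []      []       {b = false} {b′ = false} lead = inj₁ (false ∷ lead)
Lex-swap (x ∷ A) (.x ∷ A′) (x ∷ l) with Lex-swap A A′ l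
... | inj₁ l′              = inj₁ (x ∷ l′)
... | inj₂ (refl , a , a′) = inj₂ (refl , a , a′)
Lex-swap (true ∷ A) (false ∷ A′) lead = inj₁ lead

¬Lex-in-out-in-in : ∀ (A : Subset k) {B B′ : Subset n} →
                    ¬ Lex (A ++ true ∷ false ∷ B) (A ++ true ∷ true ∷ B′)
¬Lex-in-out-in-in []      (_ ∷ ())
¬Lex-in-out-in-in (x ∷ A) (_ ∷ l) = ¬Lex-in-out-in-in A l

⊆-swap : ∀ (A A′ : Subset k) {a b a′ b′} {B B′ : Subset n} →
         A ++ a ∷ b ∷ B ⊆ A′ ++ a′ ∷ b′ ∷ B′ → A ++ b ∷ a ∷ B ⊆ A′ ++ b′ ∷ a′ ∷ B′
⊆-swap []      []       p here with there here ← p (there here) = here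
⊆-swap []      []       p (there here) with here ← p here = there here
⊆-swap []      []       p (there (there q)) with there (there r) ← p (there (there q)) = there (there r)
⊆-swap (x ∷ A) (y ∷ A′) p here with here ← p here = here
⊆-swap (x ∷ A) (y ∷ A′) p (there q) = there (⊆-swap A A′ (drop-∷-⊆ p) q)

subword-++ : ∀ {X : Set a} (xs : Vec X k) (A : Subset k) (ys : Vec X n) (B : Subset n) →
             subword (xs ++ ys) (A ++ B) ≡ subword xs A List.++ subword ys B
subword-++ []       []          ys B = refl
subword-++ (x ∷ xs) (true ∷ A)  ys B = cong (x ∷_) (subword-++ xs A ys B)
subword-++ (x ∷ xs) (false ∷ A) ys B = subword-++ xs A ys B

-- Parity of multiplicities in a list.

-- Equality in W need not be decidable, so parities of multiplicities are
-- available only as a relation that is total up to double negation.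
module MultiplicityParity (X : Setoid c ℓ) where
  open Setoid X using (Carrier; _≈_) renaming (trans to ≈-trans; sym to ≈-sym)
  open ListEquality X using (_≋_; []; _∷_)

  -- The value `true` means odd. The refutation stored in `miss` is what makes the relation
  -- functional.
  data Parity (r : Carrier) : List Carrier → Bool → Set (c ⊔ ℓ) where
    []   : Parity r [] false
    hit  : ∀ {x xs b} → r ≈ x → Parity r xs b → Parity r (x ∷ xs) (not b)
    miss : ∀ {x xs b} → ¬ r ≈ x → Parity r xs b → Parity r (x ∷ xs) b

  Parity-functional : ∀ {r xs b b′} → Parity r xs b → Parity r xs b′ → b ≡ b′
  Parity-functional []         []         = refl
  Parity-functional (hit _ p)  (hit _ q)  = cong not (Parity-functional p q)
  Parity-functional (hit e _)  (miss f _) = contradiction e f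
  Parity-functional (miss f _) (hit e _)  = contradiction e f
  Parity-functional (miss _ p) (miss _ q) = Parity-functional p q

  Parity-total : ∀ r xs → ¬ ¬ ∃ (Parity r xs)
  Parity-total r []       ¬p = ¬p (_ , [])
  Parity-total r (x ∷ xs) ¬p = Parity-total r xs λ (_ , p) → ¬¬-excluded-middle λ where
    (yes e) → ¬p (_ , hit e p)
    (no f)  → ¬p (_ , miss f p)

  Parity-++ : ∀ {r xs ys b b′} → Parity r xs b → Parity r ys b′ → Parity r (xs List.++ ys) (b xor b′)
  Parity-++ []         q = q
  Parity-++ {b′ = b′} (hit {b = true}  e p) q = ≡.subst (Parity _ _) (not-involutive b′) (hit e (Parity-++ p q))
  Parity-++ (hit {b = false} e p) q = hit e (Parity-++ p q)
  Parity-++ (miss f p) q = miss f (Parity-++ p q)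

  Parity-resp-≋ : ∀ {r xs ys b} → xs ≋ ys → Parity r xs b → Parity r ys b
  Parity-resp-≋ []       []         = []
  Parity-resp-≋ (e ∷ es) (hit d p)  = hit (≈-trans d e) (Parity-resp-≋ es p)
  Parity-resp-≋ (e ∷ es) (miss d p) = miss (λ d′ → d (≈-trans d′ (≈-sym e))) (Parity-resp-≋ es p)

  odd⇒member : ∀ {r xs b} → Parity r xs b → b ≡ true → Any (r ≈_) xs
  odd⇒member (hit e _)  _   = here e
  odd⇒member (miss _ p) odd = there (odd⇒member p odd)

  -- A double negation suffices, since exchange serves only to refute. Asking for a common `b` gives
  -- transitivity through `Parity-functional`.
  SameParity : List Carrier → List Carrier → Set (c ⊔ ℓ)
  SameParity xs ys = ∀ r → ¬ ¬ ∃ λ b → Parity r xs b × Parity r ys b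

  SameParity-isEquivalence : IsEquivalence SameParity
  SameParity-isEquivalence = record
    { refl  = λ {xs} r ¬p → Parity-total r xs λ (b , p) → ¬p (b , p , p)
    ; sym   = λ s r ¬p → s r λ (b , p , q) → ¬p (b , q , p)
    ; trans = λ s t r ¬p → s r λ (b , p , q) → t r λ (b′ , q′ , u) →
        ¬p (b , p , ≡.subst (Parity r _) (Parity-functional q′ q) u)
    }

  ≋⇒SameParity : ∀ {xs ys} → xs ≋ ys → SameParity xs ys
  ≋⇒SameParity {xs} es r ¬p = Parity-total r xs λ (b , p) → ¬p (b , p , Parity-resp-≋ es p)

  -- A block occurring twice contributes `y xor y`, which is `false` for either parity `y`.
  drop-repeated : ∀ xs ys zs → SameParity (xs List.++ (ys List.++ ys) List.++ zs) (xs List.++ zs)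
  drop-repeated xs ys zs r ¬p =
    Parity-total r xs λ (x , px) → Parity-total r ys λ (y , py) → Parity-total r zs λ (z , pz) →
    ¬p (x xor z
       , ≡.subst (λ w → Parity r _ (x xor (w xor z))) (xor-same y)
           (Parity-++ px (Parity-++ (Parity-++ py py) pz))
       , Parity-++ px pz)

-- Reflections of words.

module Reflections (C : CoxeterSystem a c ℓ) where
  open CoxeterSystem C
  open Group W using (setoid; _⁻¹; ⁻¹-cong; assoc; identityˡ; identityʳ; ∙-cong; ∙-congˡ; ∙-congʳ)
    renaming (refl to ≈-refl; sym to ≈-sym; trans to ≈-trans; reflexive to ≈-reflexive)
  open GroupProperties W using (ε⁻¹≈ε; ⁻¹-anti-homo-∙; inverseˡ-unique; //-rightDividesˡ)
  open ListEquality setoid using (_≋_; []; _∷_; ≋-refl; ≋-sym; ≋-trans; ≋-reflexive; ++⁺; ++⁺ˡ)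
  open MultiplicityParity setoid
  open ≈-Reasoning setoid

  -- Generators can be compared even if elements of `W` cannot: the natural number `m s t` is 1
  -- exactly when they coincide.
  _≟_ : ∀ s t → Dec (s ≡ t)
  s ≟ t = map′ (Equivalence.to (m≡1⇔s≡t s t)) (Equivalence.from (m≡1⇔s≡t s t)) (m s t ℕ.≟ 1)

  ⟨++⟩ : ∀ α β → ⟨ α List.++ β ⟩ ≈ ⟨ α ⟩ ∙ ⟨ β ⟩
  ⟨++⟩ []      β = ≈-sym (identityˡ _)
  ⟨++⟩ (s ∷ α) β = ≈-trans (∙-congˡ (⟨++⟩ α β)) (≈-sym (assoc _ _ _))

  relator≈ε : ∀ s t → ⟨ relator s t ⟩ ≈ ε
  relator≈ε s t = ≈-trans (≈-reflexive (cong ⟨_⟩ (≡.sym (List.++-identityʳ (relator s t)))))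
    (Equivalence.from (presentation _ []) (EqClosure.return (delete [] s t [])))

  gen-involutive : ∀ s → gen s ∙ gen s ≈ ε
  gen-involutive s = ≈-trans (∙-congˡ (≈-sym (identityʳ _)))
    (≡.subst (λ k → ⟨ concat (replicate k (s ∷ s ∷ [])) ⟩ ≈ ε)
      (Equivalence.from (m≡1⇔s≡t s s) refl) (relator≈ε s s))

  gen⁻¹ : ∀ s → gen s ⁻¹ ≈ gen s
  gen⁻¹ s = ≈-sym (inverseˡ-unique _ _ (gen-involutive s))

  gen-cancel : ∀ s x → gen s ∙ (gen s ∙ x) ≈ x
  gen-cancel s x = ≈-trans (≈-sym (assoc _ _ _)) (≈-trans (∙-congʳ (gen-involutive s)) (identityˡ x))

  conj : Carrier → Carrier → Carrier
  conj g x = g ∙ x ∙ g ⁻¹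

  conj-cong : ∀ {g h x y} → g ≈ h → x ≈ y → conj g x ≈ conj h y
  conj-cong e f = ∙-cong (∙-cong e f) (⁻¹-cong e)

  conj-ε : ∀ x → conj ε x ≈ x
  conj-ε x = ≈-trans (∙-cong (identityˡ x) ε⁻¹≈ε) (identityʳ x)

  conj-∙ : ∀ g h x → conj g (conj h x) ≈ conj (g ∙ h) x
  conj-∙ g h x = begin
    g ∙ (h ∙ x ∙ h ⁻¹) ∙ g ⁻¹     ≈⟨ ∙-congʳ (assoc _ _ _) ⟨
    g ∙ (h ∙ x) ∙ h ⁻¹ ∙ g ⁻¹     ≈⟨ assoc _ _ _ ⟩
    g ∙ (h ∙ x) ∙ (h ⁻¹ ∙ g ⁻¹)   ≈⟨ ∙-cong (≈-sym (assoc _ _ _)) (≈-sym (⁻¹-anti-homo-∙ g h)) ⟩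
    g ∙ h ∙ x ∙ (g ∙ h) ⁻¹        ∎

  map-conj-≋ : ∀ g {xs ys} → xs ≋ ys → map (conj g) xs ≋ map (conj g) ys
  map-conj-≋ g []       = []
  map-conj-≋ g (e ∷ es) = conj-cong ≈-refl e ∷ map-conj-≋ g es

  map-conj-ε : ∀ {g} → g ≈ ε → ∀ xs → map (conj g) xs ≋ xs
  map-conj-ε e []       = []
  map-conj-ε e (x ∷ xs) = ≈-trans (conj-cong e ≈-refl) (conj-ε x) ∷ map-conj-ε e xs

  map-conj-∙ : ∀ g h xs → map (conj g) (map (conj h) xs) ≋ map (conj (g ∙ h)) xs
  map-conj-∙ g h []       = []
  map-conj-∙ g h (x ∷ xs) = conj-∙ g h x ∷ map-conj-∙ g h xs

  -- For α = s₁ ⋯ sₖ, the reflections s₁ ⋯ sᵢ₋₁ sᵢ sᵢ₋₁ ⋯ s₁.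
  reflections : List S → List Carrier
  reflections []      = []
  reflections (s ∷ α) = gen s ∷ map (conj (gen s)) (reflections α)

  -- A cocycle rule: a prefix only conjugates the reflections of what follows, so a factor inside a
  -- word can be isolated.
  reflections-++ : ∀ α β → reflections (α List.++ β) ≋ reflections α List.++ map (conj ⟨ α ⟩) (reflections β)
  reflections-++ []      β = ≋-sym (map-conj-ε ≈-refl _)
  reflections-++ (s ∷ α) β = ≈-refl ∷ ≋-trans (map-conj-≋ (gen s) (reflections-++ α β))
    (≋-trans (≋-reflexive (List.map-++ (conj (gen s)) (reflections α) _))
             (++⁺ˡ _ (map-conj-∙ (gen s) ⟨ α ⟩ (reflections β))))

  -- Reflections of a relator.

  translates : Carrier → Carrier → ℕ → List Carrier
  translates d = iterate (d ∙_)

  translates-cong : ∀ {d x y} → x ≈ y → ∀ k → translates d x k ≋ translates d y k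
  translates-cong e zero    = []
  translates-cong e (suc k) = e ∷ translates-cong (∙-congˡ e) k

  translates-+ : ∀ d x j k → translates d x (j ℕ.+ k) ≋
                 translates d x j List.++ translates d (fold x (d ∙_) j) k
  translates-+ d x zero    k = ≋-refl
  translates-+ d x (suc j) k = ≈-refl ∷ ≡.subst
    (λ y → translates d (d ∙ x) (j ℕ.+ k) ≋ translates d (d ∙ x) j List.++ translates d y k)
    -- Both are `j + 1` applications of `d ∙_` to `x`, with the extra one made first or last.
    (≡.trans (≡.sym (fold-+ x (d ∙_) j {1})) (cong (fold x (d ∙_)) (ℕ.+-comm j 1)))
    (translates-+ d (d ∙ x) j k)

  -- Conjugation by `d` commutes with left multiplication by `d`.
  map-conj-translates : ∀ d x k → map (conj d) (translates d x k) ≋ translates d (conj d x) k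
  map-conj-translates d x zero    = []
  map-conj-translates d x (suc k) = ≈-refl ∷
    ≋-trans (map-conj-translates d (d ∙ x) k) (translates-cong (assoc _ _ _) k)

  fold≈power : ∀ s t x k → fold x ((gen s ∙ gen t) ∙_) k ≈ ⟨ concat (replicate k (s ∷ t ∷ [])) ⟩ ∙ x
  fold≈power s t x zero    = ≈-sym (identityˡ x)
  fold≈power s t x (suc k) = begin
    gen s ∙ gen t ∙ fold x ((gen s ∙ gen t) ∙_) k  ≈⟨ ∙-congˡ (fold≈power s t x k) ⟩
    gen s ∙ gen t ∙ (_ ∙ x)                        ≈⟨ assoc _ _ _ ⟨
    gen s ∙ gen t ∙ _ ∙ x                          ≈⟨ ∙-congʳ (assoc _ _ _) ⟩
    gen s ∙ (gen t ∙ _) ∙ x                        ∎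

  -- The reflections of (st)ᵏ are (st)ⁱ s for 0 ≤ i < 2k; for k = m(s,t) the
  -- second half of them repeats the first.
  reflections-power : ∀ s t k →
    reflections (concat (replicate k (s ∷ t ∷ []))) ≋ translates (gen s ∙ gen t) (gen s) (k ℕ.+ k)
  reflections-power s t zero    = []
  reflections-power s t (suc k) = ≡.subst
    (λ j → reflections (concat (replicate (suc k) (s ∷ t ∷ []))) ≋ translates d (gen s) (suc j))
    (≡.sym (ℕ.+-suc k k))
    -- The first two entries are `s` and `s t s`. The others come from the shorter power by
    -- conjugation with `d`, so they start at `d s d⁻¹ = d d s`, where the first two leave off.
    (≈-refl ∷ sts ∷ ≋-trans (map-conj-∙ (gen s) (gen t) _)
      (≋-trans (map-conj-≋ d (reflections-power s t k))
      (≋-trans (map-conj-translates d (gen s) (k ℕ.+ k)) (translates-cong dsd⁻¹ (k ℕ.+ k)))))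
    where
    d = gen s ∙ gen t
    sts : conj (gen s) (gen t) ≈ d ∙ gen s
    sts = ∙-congˡ (gen⁻¹ s)
    dsd⁻¹ : conj d (gen s) ≈ d ∙ (d ∙ gen s)
    dsd⁻¹ = ≈-trans (assoc _ _ _) (∙-congˡ (begin
      gen s ∙ (gen s ∙ gen t) ⁻¹      ≈⟨ ∙-congˡ (⁻¹-anti-homo-∙ _ _) ⟩
      gen s ∙ (gen t ⁻¹ ∙ gen s ⁻¹)   ≈⟨ ∙-congˡ (∙-cong (gen⁻¹ t) (gen⁻¹ s)) ⟩
      gen s ∙ (gen t ∙ gen s)         ≈⟨ assoc _ _ _ ⟨
      gen s ∙ gen t ∙ gen s           ∎))

  reflections-relator : ∀ s t → ∃ λ xs → reflections (relator s t) ≋ xs List.++ xs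
  reflections-relator s t = translates d (gen s) (m s t) , ≋-trans (reflections-power s t (m s t))
    (≋-trans (translates-+ d (gen s) (m s t) (m s t)) (++⁺ˡ _ (translates-cong period (m s t))))
    where
    d = gen s ∙ gen t
    -- The relation `(s t)^m = 1` brings the translates back to `s` after `m` steps. For
    -- `m s t = 0`, that is ∞, both halves are empty.
    period : fold (gen s) (d ∙_) (m s t) ≈ gen s
    period = ≈-trans (fold≈power s t (gen s) (m s t)) (≈-trans (∙-congʳ (relator≈ε s t)) (identityˡ _))

  -- Invariance of parities, and deletion of a letter.

  ⟶⇒SameParity : ∀ {α β} → α ⟶ β → SameParity (reflections α) (reflections β)
  ⟶⇒SameParity (delete α s t β) with reflections-relator s t
  ... | xs , rel≋ = trans (≋⇒SameParity lhs) (trans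
                      (drop-repeated (reflections α) (map (conj ⟨ α ⟩) xs) (map (conj ⟨ α ⟩) (reflections β)))
                      (≋⇒SameParity (≋-sym (reflections-++ α β))))
    where
    open IsEquivalence SameParity-isEquivalence using (trans)
    ρ = relator s t
    -- The relator is trivial in `W`, so it does not conjugate the reflections of `β`; deleting it
    -- removes just the doubled list.
    inner : reflections (ρ List.++ β) ≋ (xs List.++ xs) List.++ reflections β
    inner = ≋-trans (reflections-++ ρ β) (++⁺ rel≋ (map-conj-ε (relator≈ε s t) _))
    lhs : reflections (α List.++ ρ List.++ β) ≋
          reflections α List.++ (map (conj ⟨ α ⟩) xs List.++ map (conj ⟨ α ⟩) xs)
            List.++ map (conj ⟨ α ⟩) (reflections β)
    lhs = ≋-trans (reflections-++ α (ρ List.++ β)) (++⁺ˡ (reflections α)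
      (≋-trans (map-conj-≋ ⟨ α ⟩ inner)
      (≋-reflexive (≡.trans (List.map-++ (conj ⟨ α ⟩) (xs List.++ xs) (reflections β))
        (cong (List._++ _) (List.map-++ (conj ⟨ α ⟩) xs xs))))))

  ≈⇒SameParity : ∀ α β → ⟨ α ⟩ ≈ ⟨ β ⟩ → SameParity (reflections α) (reflections β)
  ≈⇒SameParity α β e = EqClosure.gfold SameParity-isEquivalence reflections ⟶⇒SameParity
    (Equivalence.to (presentation α β) e)

  unconj : ∀ s {r x} → r ≈ conj (gen s) x → gen s ∙ r ∙ gen s ≈ x
  unconj s {r} {x} e = begin
    gen s ∙ r ∙ gen s                          ≈⟨ ∙-congʳ (∙-congˡ (≈-trans e (assoc _ _ _))) ⟩
    gen s ∙ (gen s ∙ (x ∙ gen s ⁻¹)) ∙ gen s   ≈⟨ ∙-congʳ (gen-cancel s _) ⟩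
    x ∙ gen s ⁻¹ ∙ gen s                       ≈⟨ //-rightDividesˡ (gen s) x ⟩
    x                                          ∎

  -- A generator commuting with `s` is fixed by conjugation with `s`. This is applied both to
  -- distinct commuting generators and to `t = s`.
  unconj-comm : ∀ s {t x} → gen s ∙ gen t ≈ gen t ∙ gen s → gen t ≈ conj (gen s) x → gen t ≈ x
  unconj-comm s {t} {x} comm e = begin
    gen t                  ≈⟨ gen-cancel s (gen t) ⟨
    gen s ∙ (gen s ∙ gen t) ≈⟨ ∙-congˡ comm ⟩
    gen s ∙ (gen t ∙ gen s) ≈⟨ assoc _ _ _ ⟨
    gen s ∙ gen t ∙ gen s  ≈⟨ unconj s e ⟩
    x                      ∎

  -- If `r = p s p⁻¹` comes from the letter `s` after the prefix `p`, then `r p s q = p q`. Index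
  -- sets are used so that the shorter word is again a subword of `v`.
  omit : ∀ (v : Vec S n) I {r} → Any (r ≈_) (reflections (subword v I)) →
         ∃ λ J → suc (length (subword v J)) ≡ length (subword v I) ×
                 r ∙ ⟨ subword v I ⟩ ≈ ⟨ subword v J ⟩
  omit []      []          ()
  omit (s ∷ v) (false ∷ I) p with omit v I p
  ... | J , len , e = false ∷ J , len , e
  omit (s ∷ v) (true ∷ I) (here e) =
    false ∷ I , refl , ≈-trans (∙-congʳ e) (gen-cancel s _)
  omit (s ∷ v) (true ∷ I) {r} (there p) with omit v I (Any.map (unconj s) (map⁻ p))
  ... | J , len , e = true ∷ J , cong suc len , (begin
    r ∙ (gen s ∙ w)                     ≈⟨ gen-cancel s _ ⟨
    gen s ∙ (gen s ∙ (r ∙ (gen s ∙ w))) ≈⟨ ∙-congˡ (≈-trans (≈-sym (assoc _ _ _)) (≈-sym (assoc _ _ _))) ⟩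
    gen s ∙ (gen s ∙ r ∙ gen s ∙ w)     ≈⟨ ∙-congˡ e ⟩
    gen s ∙ ⟨ subword v J ⟩             ∎)
    where w = ⟨ subword v I ⟩

-- Reduced words and the exchange condition.

module Swapping (C : CoxeterSystem a c ℓ) where
  open CoxeterSystem C
  open Sorting C
  open Reflections C
  open Group W using (setoid; assoc; ∙-congˡ; ∙-congʳ)
    renaming (refl to ≈-refl; sym to ≈-sym; trans to ≈-trans)
  open GroupProperties W using (∙-cancelˡ)
  open MultiplicityParity setoid
  open ≈-Reasoning setoid

  prefix-cong : ∀ α β γ → length γ ≡ length β × ⟨ γ ⟩ ≈ ⟨ β ⟩ →
                length (α List.++ γ) ≡ length (α List.++ β) × ⟨ α List.++ γ ⟩ ≈ ⟨ α List.++ β ⟩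
  prefix-cong α β γ (len , e) =
      ≡.trans (List.length-++ α) (≡.trans (cong (length α ℕ.+_) len) (≡.sym (List.length-++ α)))
    , ≈-trans (⟨++⟩ α γ) (≈-trans (∙-congˡ e) (≈-sym (⟨++⟩ α β)))

  reduced-transfer : ∀ {u} α β → length β ≡ length α × ⟨ β ⟩ ≈ ⟨ α ⟩ → ReducedWordFor u α → ReducedWordFor u β
  reduced-transfer α β (len , e) ((_ , shortest) , α≈u) =
    ((β , ≈-refl , refl) , λ γ γ≈β → ≡.subst (ℕ._≤ length γ) (≡.sym len) (shortest γ (≈-trans γ≈β e)))
    , ≈-trans e α≈u

  -- A shorter word for the suffix would shorten the whole word.
  reduced-suffix : ∀ α {β} → Reduced (α List.++ β) → Reduced β
  reduced-suffix α {β} (_ , shortest) = (β , ≈-refl , refl) , λ γ γ≈β →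
    ℕ.+-cancelˡ-≤ (length α) _ _ (≡.subst₂ ℕ._≤_ (List.length-++ α) (List.length-++ α)
      (shortest (α List.++ γ) (≈-trans (⟨++⟩ α γ) (≈-trans (∙-congˡ γ≈β) (≈-sym (⟨++⟩ α β))))))

  -- t is a reflection of the word t B′; it is counted once, since B′ has no letter
  -- to spare.  So it is also a reflection of s B, and is not s itself.
  exchange : ∀ {s t} → s ≢ t → gen s ∙ gen t ≈ gen t ∙ gen s →
             ∀ (v : Vec S n) B B′ → ⟨ s ∷ subword v B ⟩ ≈ ⟨ t ∷ subword v B′ ⟩ → Reduced (t ∷ subword v B′) →
             ¬ ¬ ∃ λ D → suc (length (subword v D)) ≡ length (subword v B) ×
                         gen t ∙ ⟨ subword v B ⟩ ≈ ⟨ subword v D ⟩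
  exchange {s = s} {t} s≢t comm v B B′ e (_ , shortest) ¬D =
    ≈⇒SameParity (s ∷ subword v B) (t ∷ subword v B′) e (gen t) λ where
      -- `gen t` heads the reflections of `t B′`. If it is even in the rest, it is odd in total,
      -- hence occurs for `s B`; if it is odd in the rest, it occurs there again.
      (_ , p , hit {b = false} _ _) → t∉sB (odd⇒member p refl)
      (_ , _ , hit {b = true} _ q)  → t∉tB′ (odd⇒member q refl)
      (_ , _ , miss t≉t _)          → t≉t ≈-refl
    where
    t∉tB′ : ¬ Any (gen t ≈_) (map (conj (gen t)) (reflections (subword v B′)))
    t∉tB′ p with omit v B′ (Any.map (unconj-comm t ≈-refl) (map⁻ p))
    -- Here `t B′` would equal a word two letters shorter.
    ... | J , len , tB′≈J = ℕ.<⇒≱ (ℕ.≤-reflexive len)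
      (ℕ.≤-trans (ℕ.n≤1+n _) (shortest (subword v J) (≈-sym tB′≈J)))
    t∉sB : ¬ Any (gen t ≈_) (reflections (s ∷ subword v B))
    t∉sB (here t≈s) = s≢t (≡.sym (gen-injective t≈s))
    t∉sB (there p)  = ¬D (omit v B (Any.map (unconj-comm s comm) (map⁻ p)))

  module _ {s t : S} (s≢t : s ≢ t) (comm : gen s ∙ gen t ≈ gen t ∙ gen s)
           (xs : Vec S k) (v : Vec S n) where

    -- Otherwise, by exchange, both swapped positions could be used, which is lexicographically smaller.
    sorted-avoids : ∀ {u} A {B B′} → IsSort (xs ++ s ∷ t ∷ v) u (A ++ true ∷ false ∷ B) →
                    ¬ ReducedWordFor u (subword (xs ++ s ∷ t ∷ v) (A ++ false ∷ true ∷ B′))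
    sorted-avoids A {B} {B′} (I-reduced , I-min) J-reduced
      rewrite subword-++ xs A (s ∷ t ∷ v) (true ∷ false ∷ B)
            | subword-++ xs A (s ∷ t ∷ v) (false ∷ true ∷ B′) =
      exchange s≢t comm v B B′ sB≈tB′ (reduced-suffix α (proj₁ J-reduced)) λ (D , len , tB≈D) →
        ¬Lex-in-out-in-in A (≤lex⇒Lex (I-min (A ++ true ∷ true ∷ D) (stD-reduced D len tB≈D)))
      where
      α = subword xs A
      sB≈tB′ : ⟨ s ∷ subword v B ⟩ ≈ ⟨ t ∷ subword v B′ ⟩
      sB≈tB′ = ∙-cancelˡ ⟨ α ⟩ _ _ (begin
        ⟨ α ⟩ ∙ ⟨ s ∷ subword v B ⟩        ≈⟨ ⟨++⟩ α _ ⟨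
        ⟨ α List.++ s ∷ subword v B ⟩      ≈⟨ proj₂ I-reduced ⟩
        _                                  ≈⟨ proj₂ J-reduced ⟨
        ⟨ α List.++ t ∷ subword v B′ ⟩     ≈⟨ ⟨++⟩ α _ ⟩
        ⟨ α ⟩ ∙ ⟨ t ∷ subword v B′ ⟩       ∎)
      stD-reduced : ∀ D → suc (length (subword v D)) ≡ length (subword v B) →
                    gen t ∙ ⟨ subword v B ⟩ ≈ ⟨ subword v D ⟩ →
                    ReducedWordFor _ (subword (xs ++ s ∷ t ∷ v) (A ++ true ∷ true ∷ D))
      stD-reduced D len tB≈D rewrite subword-++ xs A (s ∷ t ∷ v) (true ∷ true ∷ D) =
        -- `t D` has the length and the value of `B`, so it can replace `B` after `s`.
        reduced-transfer (α List.++ s ∷ subword v B) (α List.++ s ∷ t ∷ subword v D)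
          (prefix-cong α (s ∷ subword v B) (s ∷ t ∷ subword v D) (cong suc len , ∙-congˡ tD≈B))
          I-reduced
        where
        tD≈B : gen t ∙ ⟨ subword v D ⟩ ≈ ⟨ subword v B ⟩
        tD≈B = ≈-trans (∙-congˡ (≈-sym tB≈D)) (gen-cancel t _)

  -- Transport along an exchange of commuting letters.

  -- Stated by decomposition instead of positions, so that matching exposes the common prefix, the
  -- two letters and the common tail.
  data CommutingSwap : Vec S n → Vec S n → Set (a ⊔ ℓ) where
    swapAfter : ∀ (xs : Vec S k) s t (v : Vec S n) → gen s ∙ gen t ≈ gen t ∙ gen s →
                CommutingSwap (xs ++ s ∷ t ∷ v) (xs ++ t ∷ s ∷ v)

  CommutingSwap-sym : ∀ {ω ζ : Vec S n} → CommutingSwap ω ζ → CommutingSwap ζ ω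
  CommutingSwap-sym (swapAfter xs s t v comm) = swapAfter xs t s v (≈-sym comm)

  lookup-injective : ∀ (v w : Vec S n) → (∀ i → lookup v i ≡ lookup w i) → v ≡ w
  lookup-injective v w e = ≡.trans (≡.sym (tabulate∘lookup v)) (≡.trans (tabulate-cong e) (tabulate∘lookup w))

  commutingSwap : ∀ (ω ζ : Vec S n) i j → toℕ j ≡ suc (toℕ i) →
                  lookup ω i ≡ lookup ζ j → lookup ω j ≡ lookup ζ i →
                  gen (lookup ω i) ∙ gen (lookup ω j) ≈ gen (lookup ω j) ∙ gen (lookup ω i) →
                  (∀ k → k ≢ i → k ≢ j → lookup ω k ≡ lookup ζ k) → CommutingSwap ω ζ
  commutingSwap (s ∷ t ∷ v) (_ ∷ _ ∷ v′) zero (suc zero) _ refl refl comm rest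
    with refl ← lookup-injective v v′ (λ k → rest (suc (suc k)) (λ ()) (λ ()))
    = swapAfter [] s t v comm
  commutingSwap (x ∷ ω) (y ∷ ζ) (suc i) (suc j) j≡1+i e f comm rest
    with refl ← rest zero (λ ()) (λ ())
       | commutingSwap ω ζ i j (ℕ.suc-injective j≡1+i) e f comm
           (λ k k≢i k≢j → rest (suc k) (λ { refl → k≢i refl }) (λ { refl → k≢j refl }))
  ... | swapAfter xs s t v comm′ = swapAfter (x ∷ xs) s t v comm′

  data Split (k : ℕ) : Subset (k ℕ.+ suc (suc n)) → Set where
    split : ∀ (A : Subset k) a b (B : Subset n) → Split k (A ++ a ∷ b ∷ B)

  splitSubset : ∀ k (I : Subset (k ℕ.+ suc (suc n))) → Split k I
  splitSubset k I with A , a ∷ b ∷ B , refl ← splitAt k I = split A a b B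

  module _ {s t : S} (comm : gen s ∙ gen t ≈ gen t ∙ gen s) (xs : Vec S k) (v : Vec S n) where
    private
      ω = xs ++ s ∷ t ∷ v
      ζ = xs ++ t ∷ s ∷ v

    -- The two subwords differ only if both bits are set, and then by the order of two adjacent
    -- commuting letters.
    subword-swap : ∀ A a b B → let α = subword ω (A ++ a ∷ b ∷ B) ; β = subword ζ (A ++ b ∷ a ∷ B) in
                   length β ≡ length α × ⟨ β ⟩ ≈ ⟨ α ⟩
    subword-swap A a b B
      rewrite subword-++ xs A (s ∷ t ∷ v) (a ∷ b ∷ B) | subword-++ xs A (t ∷ s ∷ v) (b ∷ a ∷ B) =
        prefix-cong (subword xs A) (subword (s ∷ t ∷ v) (a ∷ b ∷ B)) (subword (t ∷ s ∷ v) (b ∷ a ∷ B)) (tail a b)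
      where
      tail : ∀ a b → let β = subword (s ∷ t ∷ v) (a ∷ b ∷ B) ; γ = subword (t ∷ s ∷ v) (b ∷ a ∷ B) in
             length γ ≡ length β × ⟨ γ ⟩ ≈ ⟨ β ⟩
      tail true  true  = refl , ≈-trans (≈-sym (assoc _ _ _)) (≈-trans (∙-congʳ (≈-sym comm)) (assoc _ _ _))
      tail true  false = refl , ≈-refl
      tail false true  = refl , ≈-refl
      tail false false = refl , ≈-refl

    reduced-swap : ∀ {u} A a b B → ReducedWordFor u (subword ω (A ++ a ∷ b ∷ B)) →
                   ReducedWordFor u (subword ζ (A ++ b ∷ a ∷ B))
    reduced-swap A a b B =
      reduced-transfer (subword ω (A ++ a ∷ b ∷ B)) (subword ζ (A ++ b ∷ a ∷ B)) (subword-swap A a b B)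

  sort-swap : ∀ {s t} → s ≢ t → (comm : gen s ∙ gen t ≈ gen t ∙ gen s) (xs : Vec S k) (v : Vec S n) →
              ∀ {u} A a b B → IsSort (xs ++ s ∷ t ∷ v) u (A ++ a ∷ b ∷ B) →
              IsSort (xs ++ t ∷ s ∷ v) u (A ++ b ∷ a ∷ B)
  sort-swap {k = k} {s = s} {t} s≢t comm xs v {u} A a b B sorted@(I-reduced , I-min) =
    reduced-swap comm xs v A a b B I-reduced , minimal
    where
    minimal : ∀ J → ReducedWordFor u (subword (xs ++ t ∷ s ∷ v) J) → (A ++ b ∷ a ∷ B) ≤lex J
    minimal J J-reduced with splitSubset k J
    ... | split A′ b′ a′ B′
      -- A competitor for the second word is carried back to the first, where minimality of the
      -- sorted index set applies.
      with σJ-reduced ← reduced-swap (≈-sym comm) xs v A′ b′ a′ B′ J-reduced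
      with Lex-swap A A′ (≤lex⇒Lex (I-min _ σJ-reduced))
    ... | inj₁ l = Lex⇒≤lex l
    ... | inj₂ (refl , (refl , refl) , (refl , refl)) =
      contradiction σJ-reduced (sorted-avoids s≢t comm xs v A sorted)

  W-swap : ∀ {ω ζ : Vec S n} → CommutingSwap ω ζ → ∀ {u} → u ∈ W⟨ ω ⟩ → u ∈ W⟨ ζ ⟩
  W-swap (swapAfter {k = k} xs s t v comm) (I , I≈u) with splitSubset k I
  ... | split A a b B = A ++ b ∷ a ∷ B , ≈-trans (proj₂ (subword-swap comm xs v A a b B)) I≈u

  ≤-swap : ∀ {ω ζ : Vec S n} → CommutingSwap ω ζ → ∀ {u w} → u ≤[ ω ] w → u ≤[ ζ ] w
  ≤-swap (swapAfter {k = k} xs s t v comm) u≤w@(I , J , I-sort , J-sort , I⊆J) with s ≟ t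
  -- For equal letters the bit exchange need not preserve sorted index sets, but then the two words
  -- are the same.
  ... | yes refl = u≤w
  ... | no s≢t with splitSubset k I | splitSubset k J
  ...   | split A a b B | split A′ a′ b′ B′ =
    A ++ b ∷ a ∷ B , A′ ++ b′ ∷ a′ ∷ B′ ,
    sort-swap s≢t comm xs v A a b B I-sort , sort-swap s≢t comm xs v A′ a′ b′ B′ J-sort ,
    ⊆-swap A A′ I⊆J

lemma4p7 : ∀ {a c ℓ} (C : CoxeterSystem a c ℓ) →
    let open CoxeterSystem C
        open Sorting C
    in ∀ {n} (ω ζ : Vec S n) (i j : Fin n) →
       toℕ j ≡ suc (toℕ i) →
       lookup ω i ≡ lookup ζ j →
       lookup ω j ≡ lookup ζ i →
       gen (lookup ω i) ∙ gen (lookup ω j) ≈ gen (lookup ω j) ∙ gen (lookup ω i) →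
       (∀ k → k ≢ i → k ≢ j → lookup ω k ≡ lookup ζ k) →
       (W⟨ ω ⟩ ≐ W⟨ ζ ⟩) ×
       (∀ u w → u ∈ W⟨ ω ⟩ → w ∈ W⟨ ω ⟩ → (u ≤[ ω ] w ⇔ u ≤[ ζ ] w))
lemma4p7 C ω ζ i j j≡1+i ωi≡ζj ωj≡ζi comm rest =
  -- The exchange is symmetric, so each direction is an instance of the same lemma.
  (W-swap swap , W-swap swap⁻¹) , λ _ _ _ _ → mk⇔ (≤-swap swap) (≤-swap swap⁻¹)
  where
  open Swapping C
  swap   = commutingSwap ω ζ i j j≡1+i ωi≡ζj ωj≡ζi comm rest
  swap⁻¹ = CommutingSwap-sym swap
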